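{- Let $\mathcal{A}=(Q,X,q_0,T,F)$ be an updatable timed automaton and let $\mathcal{G}=(\mathcal{G}(q))_{q\in Q}$ be a reduced $\mathcal{G}$-map for $\mathcal{A}$. Then the relation $\sqsubseteq_{\mathcal{G}}$ on configurations of $\mathcal{A}$, defined by $(q,v)\sqsubseteq_{\mathcal{G}}(q',v')$ iff $q=q'$ and $v\sqsubseteq_{\mathcal{G}(q)}v'$, is a simulation.
   Context: Clocks and constraints. $X$ is a finite set of clocks; a valuation is a map $v:X\to\mathbb{R}_{\ge 0}$; $\mathbb{V}$ is the set of valuations; $(v+\delta)(x)=v(x)+\delta$ for $\delta\in\mathbb{R}_{\ge 0}$. Below $\triangleleft,\triangleleft_1$ each denote one of $<,\le$ (not necessarily the same). An atomic constraint is a non-diagonal constraint $x\triangleleft c$ or $c\triangleleft x$, a diagonal constraint $x-y\triangleleft c$ or $c\triangleleft x-y$ (with $x,y\in X$, $c\in\mathbb{N}$), or one of $\top$ (true), $\bot$ (false). A constraint (guard) is a finite conjunction of atomic constraints; "$g$ contains $\psi$" means $\psi$ is one of the atomic conjuncts of $g$; $v\models\varphi$ denotes satisfaction. Updates. An update $up$ assigns to each clock $x$ an expression $up_x$ which is either $c$ with $c\in\mathbb{N}$ or $y+d$ with $y\in X$ (possibly $y=x$), $d\in\mathbb{Z}$. For a valuation $v$, $v(up_x)$ is $c$ or $v(y)+d$ respectively; $up(v)\ge 0$ (i.e. $up(v)$ is defined) iff $v(up_x)\ge 0$ for all $x$, and then $up(v)(x)=v(up_x)$. UTA. An updatable timed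 automaton (UTA) $\mathcal{A}=(Q,X,q_0,T,F)$ has a finite set $Q$ of states, a finite set $X$ of clocks, initial state $q_0$, finite set $T$ of transitions $(q,g,up,q')$ (source $q$, guard $g$, update $up$, target $q'$), and accepting states $F\subseteq Q$. A configuration is a pair $(q,v)$, $q\in Q$, $v\in\mathbb{V}$. Delay transitions: $(q,v)\xrightarrow{\delta}(q,v+\delta)$ for $\delta\in\mathbb{R}_{\ge0}$. Action transitions: for $t=(q,g,up,q')\in T$, $(q,v)\xrightarrow{t}(q',v')$ iff $v\models g$, $up(v)\ge 0$ and $v'=up(v)$. Inverse update. $up^{ -1}(\varphi)$ is obtained from $\varphi$ by simultaneously substituting $up_x$ for every clock $x$, and rewriting the result into an equivalent (over $\mathbb{V}$) constraint built from atomic constraints of the forms $x\triangleleft c$, $c\triangleleft x$, $x-y\triangleleft c$, $c\triangleleft x-y$ (with $x,y\in X$, $c\in\mathbb{N}$), $\top$, $\bot$: constants are collected on one side; for $c>0$, $x-y\triangleleft -c$ is rewritten $c\triangleleft y-x$ and $-c\triangleleft x-y$ is rewritten $y-x\triangleleft c$; results equivalent over $\mathbb{V}$ to true or false (e.g. $0\le x$, or $x\le -1$) are identified with $\top$, resp. $\bot$. Pre. For a guard $g$, update $up$ and atomic constraint $\varphi$, the atomic constraint $\mathrm{pre}(\varphi,g,up)$ is defined by: (1) if $up^{ -1}(\varphi)$ is $x\triangleleft d$ and $g$ contains some $x\triangleleft_1 c$, then it is $\top$; (2) if $up^{ -1}(\varphi)$ is $d\triangleleft x$ and $g$ contains some $x\triangleleft_1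 c$ with $c<d$, then it is $c\le x$ (if several such $c$ exist, one is fixed); (3) if $up^{ -1}(\varphi)$ is $x-y\triangleleft d$ or $d\triangleleft x-y$, and $g$ contains some $x\triangleleft_1 c$ with $c<d$, or some $x-y\triangleleft_1 c$ with $c<d$, or some $e\triangleleft_1 x-y$ with $d<e$, then it is $\top$; in all other cases it is $up^{ -1}(\varphi)$. Reduced $\mathcal{G}$-map. A reduced $\mathcal{G}$-map for $\mathcal{A}$ is a family $(\mathcal{G}(q))_{q\in Q}$ of (finite or infinite) sets of atomic constraints such that for every transition $(q,g,up,q')\in T$: every atomic constraint of $g$ belongs to $\mathcal{G}(q)$; $\mathrm{pre}(0\le x,g,up)\in\mathcal{G}(q)$ for every $x\in X$; and $\mathrm{pre}(\varphi,g,up)\in\mathcal{G}(q)$ for every $\varphi\in\mathcal{G}(q')$. $G$-preorder. For a set $G$ of constraints, $v\sqsubseteq_G v'$ iff for every $\delta\ge 0$ and every $\varphi\in G$: $v+\delta\models\varphi$ implies $v'+\delta\models\varphi$. Simulation. A simulation is a preorder $\sqsubseteq$ relating only configurations with the same state such that $(q,v)\sqsubseteq(q,v')$ implies: $(q,v+\delta)\sqsubseteq(q,v'+\delta)$ for all $\delta\in\mathbb{R}_{\ge 0}$; and for every $t=(q,g,up,q_1)\in T$, if $(q,v)\xrightarrow{t}(q_1,v_1)$ then $(q,v')\xrightarrow{t}(q_1,v_1')$ for some $v'_1$ with $(q_1,v_1)\sqsubseteq(q_1,v_1')$. -}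

module Defs where

open import Data.Bool.Base using (Bool; if_then_else_; _∨_)
open import Data.Empty using (⊥)
open import Data.Fin.Base using (Fin)
import Data.Fin.Properties as Fin
open import Data.Fin.Subset using (Subset)
open import Data.Integer as ℤ using (ℤ; +_; -[1+_])
open import Data.List.Base using (List; []; _∷_; filter; mapMaybe)
open import Data.List.Membership.Propositional using (_∈_)
open import Data.List.NonEmpty.Base using (List⁺; toList) renaming (_∷_ to _∷⁺_)
open import Data.List.Relation.Unary.All using (All)
open import Data.List.Relation.Unary.Any using (any?)
open import Data.Maybe.Base using (Maybe; just; nothing)
open import Data.Nat.Base as ℕ using (ℕ; zero; suc)
import Data.Nat.Properties as ℕ
open import Data.Product.Base using (∃-syntax; _×_; _,_; proj₁; proj₂)
open import Data.Rational.Base as ℚ using (ℚ; 0ℚ; ½; ∣_∣)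
import Data.Rational.Properties as ℚ
open import Data.Unit.Base using (⊤)
open import Relation.Binary.Core using (Rel)
open import Relation.Binary.PropositionalEquality using (_≡_; refl; sym; trans; cong; subst; subst₂)
open import Relation.Binary.Structures using (IsPreorder)
open import Relation.Nullary.Decidable using (does; _×-dec_)
open import Relation.Unary using (Pred)

-- ℝ is the setoid of Cauchy sequences of rationals, with equality _≈_.

IsCauchy : (ℕ → ℚ) → Set
IsCauchy s = ∀ ε → 0ℚ ℚ.< ε → ∃[ N ] (∀ m n → N ℕ.≤ m → N ℕ.≤ n → ∣ s m ℚ.- s n ∣ ℚ.≤ ε)

record ℝ : Set where
  constructor mkℝ
  field
    seq    : ℕ → ℚ
    cauchy : IsCauchy seq

open ℝ public

infix 4 _≤_ _<_ _≈_
infixl 6 _+_ _-_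

_≤_ : ℝ → ℝ → Set
x ≤ y = ∀ ε → 0ℚ ℚ.< ε → ∃[ N ] (∀ n → N ℕ.≤ n → seq x n ℚ.≤ seq y n ℚ.+ ε)

_<_ : ℝ → ℝ → Set
x < y = ∃[ ε ] (0ℚ ℚ.< ε × ∃[ N ] (∀ n → N ℕ.≤ n → seq x n ℚ.+ ε ℚ.≤ seq y n))

_≈_ : ℝ → ℝ → Set
x ≈ y = ∀ ε → 0ℚ ℚ.< ε → ∃[ N ] (∀ n → N ℕ.≤ n → ∣ seq x n ℚ.- seq y n ∣ ℚ.≤ ε)

abstract

  half-pos : ∀ {ε} → 0ℚ ℚ.< ε → 0ℚ ℚ.< ε ℚ.* ½
  half-pos {ε} 0<ε = subst (ℚ._< ε ℚ.* ½) (ℚ.*-zeroˡ ½) (ℚ.*-monoˡ-<-pos ½ 0<ε)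

  half+half : ∀ ε → ε ℚ.* ½ ℚ.+ ε ℚ.* ½ ≡ ε
  half+half ε = trans (sym (ℚ.*-distribˡ-+ ε ½ ½)) (ℚ.*-identityʳ ε)

  interchange : ∀ a b c d → (a ℚ.+ b) ℚ.+ (c ℚ.+ d) ≡ (a ℚ.+ c) ℚ.+ (b ℚ.+ d)
  interchange a b c d =
    trans (ℚ.+-assoc a b (c ℚ.+ d))
    (trans (cong (a ℚ.+_) (trans (sym (ℚ.+-assoc b c d))
                          (trans (cong (ℚ._+ d) (ℚ.+-comm b c)) (ℚ.+-assoc c b d))))
           (sym (ℚ.+-assoc a c (b ℚ.+ d))))

  const-cauchy : ∀ p → IsCauchy (λ _ → p)
  const-cauchy p ε 0<ε = 0 , λ _ _ _ _ →
    subst (ℚ._≤ ε) (sym (cong ∣_∣ (ℚ.+-inverseʳ p))) (ℚ.<⇒≤ 0<ε)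

  neg-cauchy : ∀ s → IsCauchy s → IsCauchy (λ n → ℚ.- s n)
  neg-cauchy s cs ε 0<ε =
    let N , h = cs ε 0<ε in
    N , λ m n N≤m N≤n → subst (ℚ._≤ ε) (eq (s m) (s n)) (h m n N≤m N≤n)
    where
    eq : ∀ a b → ∣ a ℚ.- b ∣ ≡ ∣ ℚ.- a ℚ.- (ℚ.- b) ∣
    eq a b = trans (sym (ℚ.∣-p∣≡∣p∣ (a ℚ.- b))) (cong ∣_∣ (ℚ.neg-distrib-+ a (ℚ.- b)))

  +-cauchy : ∀ s t → IsCauchy s → IsCauchy t → IsCauchy (λ n → s n ℚ.+ t n)
  +-cauchy s t cs ct ε 0<ε =
    let M , hs = cs (ε ℚ.* ½) (half-pos 0<ε)
        N , ht = ct (ε ℚ.* ½) (half-pos 0<ε)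
    in M ℕ.⊔ N , λ m n p q →
       bound (s m) (s n) (t m) (t n)
         (hs m n (ℕ.m⊔n≤o⇒m≤o M N p) (ℕ.m⊔n≤o⇒m≤o M N q))
         (ht m n (ℕ.m⊔n≤o⇒n≤o M N p) (ℕ.m⊔n≤o⇒n≤o M N q))
    where
    regroup : ∀ a b c d → (a ℚ.- b) ℚ.+ (c ℚ.- d) ≡ (a ℚ.+ c) ℚ.- (b ℚ.+ d)
    regroup a b c d = trans (interchange a (ℚ.- b) c (ℚ.- d))
                            (cong (a ℚ.+ c ℚ.+_) (sym (ℚ.neg-distrib-+ b d)))
    bound : ∀ a b c d → ∣ a ℚ.- b ∣ ℚ.≤ ε ℚ.* ½ → ∣ c ℚ.- d ∣ ℚ.≤ ε ℚ.* ½ →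
            ∣ (a ℚ.+ c) ℚ.- (b ℚ.+ d) ∣ ℚ.≤ ε
    bound a b c d p q = subst₂ ℚ._≤_ (cong ∣_∣ (regroup a b c d)) (half+half ε)
      (ℚ.≤-trans (ℚ.∣p+q∣≤∣p∣+∣q∣ (a ℚ.- b) (c ℚ.- d)) (ℚ.+-mono-≤ p q))

fromℤ : ℤ → ℝ
fromℤ i = mkℝ (λ _ → i ℚ./ 1) (const-cauchy (i ℚ./ 1))

fromℕ : ℕ → ℝ
fromℕ n = fromℤ (+ n)

-_ : ℝ → ℝ
- x = mkℝ (λ n → ℚ.- seq x n) (neg-cauchy (seq x) (cauchy x))

_+_ : ℝ → ℝ → ℝ
x + y = mkℝ (λ n → seq x n ℚ.+ seq y n) (+-cauchy (seq x) (seq y) (cauchy x) (cauchy y))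

_-_ : ℝ → ℝ → ℝ
x - y = x + (- y)

abstract

  +-nonneg : ∀ x y → fromℕ 0 ≤ x → fromℕ 0 ≤ y → fromℕ 0 ≤ x + y
  +-nonneg x y 0≤x 0≤y ε 0<ε =
    let M , hx = 0≤x (ε ℚ.* ½) (half-pos 0<ε)
        N , hy = 0≤y (ε ℚ.* ½) (half-pos 0<ε)
    in M ℕ.⊔ N , λ n p →
       subst (0ℚ ℚ.≤_) (trans (interchange (seq x n) (ε ℚ.* ½) (seq y n) (ε ℚ.* ½))
                              (cong (seq x n ℚ.+ seq y n ℚ.+_) (half+half ε)))
         (ℚ.+-mono-≤ (hx n (ℕ.m⊔n≤o⇒m≤o M N p)) (hy n (ℕ.m⊔n≤o⇒n≤o M N p)))

record ℝ≥0 : Set where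
  constructor mkℝ≥0
  field
    value  : ℝ
    nonneg : fromℕ 0 ≤ value

open ℝ≥0 public

Valuation : ℕ → Set
Valuation n = Fin n → ℝ≥0

infix 4 _≈ᵛ_
_≈ᵛ_ : ∀ {n} → Valuation n → Valuation n → Set
v ≈ᵛ w = ∀ x → value (v x) ≈ value (w x)

infixl 6 _⊕_
_⊕_ : ∀ {n} → Valuation n → ℝ≥0 → Valuation n
(v ⊕ δ) x = mkℝ≥0 (value (v x) + value δ)
                  (+-nonneg (value (v x)) (value δ) (nonneg (v x)) (nonneg δ))

data Ineq : Set where
  lt le : Ineq

infix 4 _⟨_⟩_
_⟨_⟩_ : ℝ → Ineq → ℝ → Set
a ⟨ lt ⟩ b = a < b
a ⟨ le ⟩ b = a ≤ b

data Atom (n : ℕ) : Set where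
  upper     : Fin n → Ineq → ℕ → Atom n           -- x ◁ c
  lower     : ℕ → Ineq → Fin n → Atom n           -- c ◁ x
  diffUpper : Fin n → Fin n → Ineq → ℕ → Atom n   -- x - y ◁ c
  diffLower : ℕ → Ineq → Fin n → Fin n → Atom n   -- c ◁ x - y
  true      : Atom n
  false     : Atom n

Guard : ℕ → Set
Guard n = List (Atom n)

infix 4 _⊨_ _⊨ᵍ_
_⊨_ : ∀ {n} → Valuation n → Atom n → Set
v ⊨ upper x ◁ c       = value (v x) ⟨ ◁ ⟩ fromℕ c
v ⊨ lower c ◁ x       = fromℕ c ⟨ ◁ ⟩ value (v x)
v ⊨ diffUpper x y ◁ c = (value (v x) - value (v y)) ⟨ ◁ ⟩ fromℕ c
v ⊨ diffLower c ◁ x y = fromℕ c ⟨ ◁ ⟩ (value (v x) - value (v y))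
v ⊨ true              = ⊤
v ⊨ false             = ⊥

_⊨ᵍ_ : ∀ {n} → Valuation n → Guard n → Set
v ⊨ᵍ g = All (v ⊨_) g

data Expr (n : ℕ) : Set where
  const : ℕ → Expr n            -- c
  shift : Fin n → ℤ → Expr n    -- y + d

Update : ℕ → Set
Update n = Fin n → Expr n

eval : ∀ {n} → Valuation n → Expr n → ℝ
eval v (const c)   = fromℕ c
eval v (shift y d) = value (v y) + fromℤ d

Defined : ∀ {n} → Update n → Valuation n → Set
Defined up v = ∀ x → fromℕ 0 ≤ eval v (up x)

apply : ∀ {n} (up : Update n) (v : Valuation n) → Defined up v → Valuation n
apply up v up≥0 x = mkℝ≥0 (eval v (up x)) (up≥0 x)

infix 4 _⟨_⟩ℤ?_
_⟨_⟩ℤ?_ : ℤ → Ineq → ℤ → Bool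
i ⟨ lt ⟩ℤ? j = does (i ℤ.<? j)
i ⟨ le ⟩ℤ? j = does (i ℤ.≤? j)

truth : ∀ {n} → Bool → Atom n
truth b = if b then true else false

-- The next four functions give the atomic constraints equivalent, over
-- nonnegative valuations, to x ◁ i, i ◁ x, x - y ◁ i and i ◁ x - y for an
-- integer i.  Exactly the valid and the unsatisfiable ones become true
-- and false.

upperℤ : ∀ {n} → Fin n → Ineq → ℤ → Atom n
upperℤ x lt (+ zero)  = false
upperℤ x ◁  (+ c)     = upper x ◁ c
upperℤ x ◁  -[1+ _ ]  = false

lowerℤ : ∀ {n} → ℤ → Ineq → Fin n → Atom n
lowerℤ (+ zero)  le x = true
lowerℤ (+ c)     ◁  x = lower c ◁ x
lowerℤ -[1+ _ ]  ◁  x = true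

diffUpperℤ : ∀ {n} → Fin n → Fin n → Ineq → ℤ → Atom n
diffUpperℤ x y ◁ i = if does (x Fin.≟ y) then truth (+ 0 ⟨ ◁ ⟩ℤ? i) else distinct i
  where
  distinct : ℤ → Atom _
  distinct (+ c)     = diffUpper x y ◁ c
  distinct -[1+ c ]  = diffLower (suc c) ◁ y x

diffLowerℤ : ∀ {n} → ℤ → Ineq → Fin n → Fin n → Atom n
diffLowerℤ i ◁ x y = if does (x Fin.≟ y) then truth (i ⟨ ◁ ⟩ℤ? + 0) else distinct i
  where
  distinct : ℤ → Atom _
  distinct (+ c)     = diffLower c ◁ x y
  distinct -[1+ c ]  = diffUpper y x ◁ (suc c)

substUpper : ∀ {n} → Expr n → Ineq → ℤ → Atom n
substUpper (const k)   ◁ i = truth (+ k ⟨ ◁ ⟩ℤ? i)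
substUpper (shift y d) ◁ i = upperℤ y ◁ (i ℤ.- d)

substLower : ∀ {n} → ℤ → Ineq → Expr n → Atom n
substLower i ◁ (const k)   = truth (i ⟨ ◁ ⟩ℤ? + k)
substLower i ◁ (shift y d) = lowerℤ (i ℤ.- d) ◁ y

substDiffUpper : ∀ {n} → Expr n → Expr n → Ineq → ℤ → Atom n
substDiffUpper e           (const l)   ◁ i = substUpper e ◁ (i ℤ.+ + l)
substDiffUpper (const k)   (shift z e) ◁ i = lowerℤ (+ k ℤ.- e ℤ.- i) ◁ z
substDiffUpper (shift y d) (shift z e) ◁ i = diffUpperℤ y z ◁ (i ℤ.+ e ℤ.- d)

substDiffLower : ∀ {n} → ℤ → Ineq → Expr n → Expr n → Atom n
substDiffLower i ◁ e           (const l)   = substLower (i ℤ.+ + l) ◁ e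
substDiffLower i ◁ (const k)   (shift z e) = upperℤ z ◁ (+ k ℤ.- e ℤ.- i)
substDiffLower i ◁ (shift y d) (shift z e) = diffLowerℤ (i ℤ.+ e ℤ.- d) ◁ y z

_⁻¹[_] : ∀ {n} → Update n → Atom n → Atom n
up ⁻¹[ upper x ◁ c ]       = substUpper (up x) ◁ (+ c)
up ⁻¹[ lower c ◁ x ]       = substLower (+ c) ◁ (up x)
up ⁻¹[ diffUpper x y ◁ c ] = substDiffUpper (up x) (up y) ◁ (+ c)
up ⁻¹[ diffLower c ◁ x y ] = substDiffLower (+ c) ◁ (up x) (up y)
up ⁻¹[ true ]              = true
up ⁻¹[ false ]             = false

uppers : ∀ {n} → Fin n → Guard n → List ℕ
uppers {n} x = mapMaybe bound
  where
  bound : Atom n → Maybe ℕ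
  bound (upper z _ c) = if does (z Fin.≟ x) then just c else nothing
  bound _             = nothing

diffUppers : ∀ {n} → Fin n → Fin n → Guard n → List ℕ
diffUppers {n} x y = mapMaybe bound
  where
  bound : Atom n → Maybe ℕ
  bound (diffUpper z w _ c) = if does ((z Fin.≟ x) ×-dec (w Fin.≟ y)) then just c else nothing
  bound _                   = nothing

diffLowers : ∀ {n} → Fin n → Fin n → Guard n → List ℕ
diffLowers {n} x y = mapMaybe bound
  where
  bound : Atom n → Maybe ℕ
  bound (diffLower c _ z w) = if does ((z Fin.≟ x) ×-dec (w Fin.≟ y)) then just c else nothing
  bound _                   = nothing

-- An arbitrary rule fixing one c when several are eligible in pre(φ, g, up).
record Selector (n : ℕ) : Set where
  field
    select   : Atom n → Guard n → Update n → List⁺ ℕ → ℕ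
    select-∈ : ∀ φ g up cs → select φ g up cs ∈ toList cs

preUpper : ∀ {n} → Guard n → Fin n → Ineq → ℕ → Atom n
preUpper g x ◁ d with uppers x g
... | []    = upper x ◁ d
... | _ ∷ _ = true

preLower : ∀ {n} → (List⁺ ℕ → ℕ) → Guard n → ℕ → Ineq → Fin n → Atom n
preLower choose g d ◁ x with filter (ℕ._<? d) (uppers x g)
... | []     = lower d ◁ x
... | c ∷ cs = lower (choose (c ∷⁺ cs)) le x

diffDecided : ∀ {n} → Guard n → Fin n → Fin n → ℕ → Bool
diffDecided g x y d = does (any? (ℕ._<? d) (uppers x g))
                    ∨ does (any? (ℕ._<? d) (diffUppers x y g))
                    ∨ does (any? (d ℕ.<?_) (diffLowers x y g))

preAtom : ∀ {n} → (List⁺ ℕ → ℕ) → Guard n → Atom n → Atom n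
preAtom choose g (upper x ◁ d)           = preUpper g x ◁ d
preAtom choose g (lower d ◁ x)           = preLower choose g d ◁ x
preAtom choose g ψ@(diffUpper x y ◁ d)   = if diffDecided g x y d then true else ψ
preAtom choose g ψ@(diffLower d ◁ x y)   = if diffDecided g x y d then true else ψ
preAtom choose g true                    = true
preAtom choose g false                   = false

pre : ∀ {n} → Selector n → Atom n → Guard n → Update n → Atom n
pre S φ g up = preAtom (Selector.select S φ g up) g (up ⁻¹[ φ ])

record Transition (nQ nX : ℕ) : Set where
  field
    source : Fin nQ
    guard  : Guard nX
    update : Update nX
    target : Fin nQ

record UTA : Set where
  field
    nQ          : ℕ
    nX          : ℕ
    initial     : Fin nQ
    transitions : List (Transition nQ nX)
    accepting   : Subset nQ

  State : Set
  State = Fin nQ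

  Configuration : Set
  Configuration = State × Valuation nX

record IsReducedGMap {ℓ} (𝒜 : UTA) (S : Selector (UTA.nX 𝒜))
                     (𝒢 : UTA.State 𝒜 → Pred (Atom (UTA.nX 𝒜)) ℓ) : Set ℓ where
  open UTA 𝒜
  open Transition
  field
    guard-atoms : ∀ {t} → t ∈ transitions → ∀ {φ} → φ ∈ guard t → 𝒢 (source t) φ
    pre-nonneg  : ∀ {t} → t ∈ transitions → ∀ x →
                  𝒢 (source t) (pre S (lower 0 le x) (guard t) (update t))
    pre-closed  : ∀ {t} → t ∈ transitions → ∀ {φ} → 𝒢 (target t) φ →
                  𝒢 (source t) (pre S φ (guard t) (update t))

infix 4 _⊑[_]_
_⊑[_]_ : ∀ {n ℓ} → Valuation n → Pred (Atom n) ℓ → Valuation n → Set ℓ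
v ⊑[ G ] v' = ∀ δ φ → G φ → v ⊕ δ ⊨ φ → v' ⊕ δ ⊨ φ

module _ (𝒜 : UTA) where
  open UTA 𝒜

  infix 4 _≈ᶜ_
  _≈ᶜ_ : Rel Configuration _
  (q , v) ≈ᶜ (q' , v') = q ≡ q' × v ≈ᵛ v'

  infix 4 _—[_]→_
  record _—[_]→_ (κ : Configuration) (t : Transition nQ nX) (κ' : Configuration) : Set where
    open Transition t
    field
      at-source : proj₁ κ ≡ source
      at-target : proj₁ κ' ≡ target
      enabled   : proj₂ κ ⊨ᵍ guard
      defined   : Defined update (proj₂ κ)
      updated   : proj₂ κ' ≈ᵛ apply update (proj₂ κ) defined

  GSim : ∀ {ℓ} → (State → Pred (Atom nX) ℓ) → Rel Configuration ℓ
  GSim 𝒢 (q , v) (q' , v') = q ≡ q' × v ⊑[ 𝒢 q ] v'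

  record IsSimulation {ℓ} (_⊑_ : Rel Configuration ℓ) : Set ℓ where
    field
      isPreorder : IsPreorder _≈ᶜ_ _⊑_
      same-state : ∀ {κ κ'} → κ ⊑ κ' → proj₁ κ ≡ proj₁ κ'
      delay      : ∀ {q v v'} → (q , v) ⊑ (q , v') → ∀ δ → (q , v ⊕ δ) ⊑ (q , v' ⊕ δ)
      action     : ∀ {q v v' t q₁ v₁} → t ∈ transitions → (q , v) ⊑ (q , v') →
                   (q , v) —[ t ]→ (q₁ , v₁) →
                   ∃[ v₁' ] ((q , v') —[ t ]→ (q₁ , v₁') × (q₁ , v₁) ⊑ (q₁ , v₁'))

{-# OPTIONS --safe #-}

-- If the guard bounds y above by c, then transferring that bound after the delay c - v(y)
-- (or slightly less, if it is strict) gives v'(y) ≤ v(y), so every constraint y ◁ d transfers;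
-- transferring c ≤ y after the same delay gives v(y) ≤ v'(y), so every d ◁ y transfers.  The
-- diagonal constraints that pre drops have the same truth value in all valuations satisfying
-- the guard.  Hence every up⁻¹(φ) transfers, and with it φ, because delays commute with
-- updates y + d and do not affect differences of clocks.
module Submission where

open import Defs
open import Data.Bool.Base using (true; false)
open import Data.Empty using (⊥-elim)
open import Data.Fin.Base using (Fin)
import Data.Fin.Properties as Fin
open import Data.Integer as ℤ using (ℤ; +_; -[1+_])
import Data.Integer.Properties as ℤ
open import Data.List.Base using ([]; _∷_; filter)
open import Data.List.Membership.Propositional using (_∈_; find)
open import Data.List.Membership.Propositional.Properties using (∈-filter⁻)
open import Data.List.NonEmpty.Base using (toList) renaming (_∷_ to _∷⁺_)
import Data.List.Relation.Unary.All as All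
open import Data.List.Relation.Unary.Any using (here; there; any?)
open import Data.Nat.Base as ℕ using (ℕ; zero; suc)
import Data.Nat.Properties as ℕ
open import Data.Product.Base using (∃-syntax; _×_; _,_; map₂; proj₁; proj₂)
open import Data.Rational.Base as ℚ using (ℚ; 0ℚ; ½; ∣_∣)
import Data.Rational.Properties as ℚ
open import Data.Rational.Solver using (module +-*-Solver)
import Data.Rational.Unnormalised.Base as ℚᵘ
import Data.Rational.Unnormalised.Properties as ℚᵘ
open import Data.Sum.Base using (_⊎_; inj₁; inj₂)
open import Data.Unit.Base using (tt)
open import Function.Base using (_∘_; id)
open import Function.Bundles using (_⇔_; mk⇔; Equivalence)
open import Function.Properties.Equivalence using (⇔-isEquivalence)
open import Level using (0ℓ)
open import Relation.Binary.PropositionalEquality using (_≡_; refl; sym; trans; cong; cong₂; subst; subst₂)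
open import Relation.Binary.Structures using (IsEquivalence; IsPreorder)
open import Relation.Nullary.Decidable using (yes; no)
open import Relation.Nullary.Negation using (¬_)
open import Relation.Unary using (Pred)

open +-*-Solver using (solve; _:=_; _:+_; :-_; _:-_; con)
open Equivalence using (to; from)
open IsEquivalence (⇔-isEquivalence {0ℓ}) using () renaming (trans to ⇔-trans)

-- Rational arithmetic and the embedding of the integers.

-- Adding `p' - p` to both sides turns one inequality into the other. Rearranging an inequality is
-- thereby reduced to an equation for the ring solver.
≤-from-diff : ∀ {p q p' q'} → q ℚ.- p ≡ q' ℚ.- p' → p ℚ.≤ q → p' ℚ.≤ q'
≤-from-diff {p} {q} {p'} {q'} eq p≤q = subst₂ ℚ._≤_
  (solve 2 (λ p p' → p :+ (p' :- p) := p') refl p p')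
  (trans (solve 3 (λ q p p' → q :+ (p' :- p) := (q :- p) :+ p') refl q p p')
    (trans (cong (ℚ._+ p') eq) (solve 2 (λ q' p' → (q' :- p') :+ p' := q') refl q' p')))
  (ℚ.+-monoˡ-≤ (p' ℚ.- p) p≤q)

-- `_/_` normalises by a gcd that does not compute on variables, so the equation is checked on
-- unnormalised rationals, where every denominator here is 1.
/1-+ : ∀ i j → (i ℤ.+ j) ℚ./ 1 ≡ i ℚ./ 1 ℚ.+ j ℚ./ 1
/1-+ i j = ℚ.toℚᵘ-injective
  (ℚᵘ.≃-trans (ℚ.toℚᵘ-fromℚᵘ (ℚᵘ.mkℚᵘ (i ℤ.+ j) 0))
  (ℚᵘ.≃-trans (ℚᵘ.*≡* (cong (ℤ._* + 1) (sym (cong₂ ℤ._+_ (ℤ.*-identityʳ i) (ℤ.*-identityʳ j)))))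
  (ℚᵘ.≃-trans (ℚᵘ.≃-sym (ℚᵘ.+-cong (ℚ.toℚᵘ-fromℚᵘ (ℚᵘ.mkℚᵘ i 0)) (ℚ.toℚᵘ-fromℚᵘ (ℚᵘ.mkℚᵘ j 0))))
  (ℚᵘ.≃-sym (ℚ.toℚᵘ-homo-+ (i ℚ./ 1) (j ℚ./ 1))))))

/1-neg : ∀ i → (ℤ.- i) ℚ./ 1 ≡ ℚ.- (i ℚ./ 1)
/1-neg i = ℚ.toℚᵘ-injective
  (ℚᵘ.≃-trans (ℚ.toℚᵘ-fromℚᵘ (ℚᵘ.mkℚᵘ (ℤ.- i) 0))
  (ℚᵘ.≃-trans (ℚᵘ.-‿cong (ℚᵘ.≃-sym (ℚ.toℚᵘ-fromℚᵘ (ℚᵘ.mkℚᵘ i 0))))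
  (ℚᵘ.≃-sym (ℚ.toℚᵘ-homo‿- (i ℚ./ 1)))))

/1-minus : ∀ i j → (i ℤ.- j) ℚ./ 1 ≡ i ℚ./ 1 ℚ.- j ℚ./ 1
/1-minus i j = trans (/1-+ i (ℤ.- j)) (cong (i ℚ./ 1 ℚ.+_) (/1-neg j))

/1-minus-minus : ∀ i j k → (i ℤ.- j ℤ.- k) ℚ./ 1 ≡ i ℚ./ 1 ℚ.- j ℚ./ 1 ℚ.- k ℚ./ 1
/1-minus-minus i j k = trans (/1-minus (i ℤ.- j) k) (cong (ℚ._- k ℚ./ 1) (/1-minus i j))

/1-+-minus : ∀ i j k → (i ℤ.+ j ℤ.- k) ℚ./ 1 ≡ i ℚ./ 1 ℚ.+ j ℚ./ 1 ℚ.- k ℚ./ 1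
/1-+-minus i j k = trans (/1-minus (i ℤ.+ j) k) (cong (ℚ._- k ℚ./ 1) (/1-+ i j))

/1-mono-≤ : ∀ {i j} → i ℤ.≤ j → i ℚ./ 1 ℚ.≤ j ℚ./ 1
/1-mono-≤ {i} {j} i≤j = ℚ.toℚᵘ-cancel-≤
  (ℚᵘ.≤-respˡ-≃ (ℚᵘ.≃-sym (ℚ.toℚᵘ-fromℚᵘ (ℚᵘ.mkℚᵘ i 0)))
  (ℚᵘ.≤-respʳ-≃ (ℚᵘ.≃-sym (ℚ.toℚᵘ-fromℚᵘ (ℚᵘ.mkℚᵘ j 0)))
    (ℚᵘ.*≤* (ℤ.*-monoʳ-≤-nonNeg (+ 1) i≤j))))

/1-mono-< : ∀ {i j} → i ℤ.< j → i ℚ./ 1 ℚ.< j ℚ./ 1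
/1-mono-< {i} {j} i<j = ℚ.toℚᵘ-cancel-<
  (ℚᵘ.<-respˡ-≃ (ℚᵘ.≃-sym (ℚ.toℚᵘ-fromℚᵘ (ℚᵘ.mkℚᵘ i 0)))
  (ℚᵘ.<-respʳ-≃ (ℚᵘ.≃-sym (ℚ.toℚᵘ-fromℚᵘ (ℚᵘ.mkℚᵘ j 0)))
    (ℚᵘ.*<* (ℤ.*-monoʳ-<-pos (+ 1) i<j))))

-- Order and equality on ℝ

Eventually : (ℕ → Set) → Set
Eventually P = ∃[ N ] (∀ n → N ℕ.≤ n → P n)

eventually-map : ∀ {P Q : ℕ → Set} → (∀ n → P n → Q n) → Eventually P → Eventually Q
eventually-map f (N , p) = N , λ n N≤n → f n (p n N≤n)

eventually-zip : ∀ {P Q R : ℕ → Set} → (∀ n → P n → Q n → R n) →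
                 Eventually P → Eventually Q → Eventually R
eventually-zip f (M , p) (N , q) = M ℕ.⊔ N , λ n h →
  f n (p n (ℕ.m⊔n≤o⇒m≤o M N h)) (q n (ℕ.m⊔n≤o⇒n≤o M N h))

≤-eventually : ∀ {a b} → Eventually (λ n → seq a n ℚ.≤ seq b n) → a ≤ b
≤-eventually {a} {b} h ε 0<ε = eventually-map
  (λ n p → subst (ℚ._≤ seq b n ℚ.+ ε) (ℚ.+-identityʳ (seq a n)) (ℚ.+-mono-≤ p (ℚ.<⇒≤ 0<ε)))
  h

≤-pointwise : ∀ {a b} → (∀ n → seq a n ℚ.≤ seq b n) → a ≤ b
≤-pointwise {a} {b} h = ≤-eventually {a} {b} (0 , λ n _ → h n)

≤-+-pos : ∀ {p ε} → 0ℚ ℚ.< ε → p ℚ.≤ p ℚ.+ ε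
≤-+-pos {p} {ε} 0<ε = subst (ℚ._≤ p ℚ.+ ε) (ℚ.+-identityʳ p) (ℚ.+-monoʳ-≤ p (ℚ.<⇒≤ 0<ε))

≤-refl : ∀ {a} → a ≤ a
≤-refl {a} = ≤-pointwise {a} {a} (λ n → ℚ.≤-refl)

≤-trans : ∀ {a b c} → a ≤ b → b ≤ c → a ≤ c
≤-trans {a} {b} {c} a≤b b≤c ε 0<ε = eventually-zip
  (λ n p q → subst (seq a n ℚ.≤_) (trans (ℚ.+-assoc (seq c n) _ _) (cong (seq c n ℚ.+_) (half+half ε)))
               (ℚ.≤-trans p (ℚ.+-monoˡ-≤ (ε ℚ.* ½) q)))
  (a≤b _ (half-pos 0<ε)) (b≤c _ (half-pos 0<ε))

-- Half of the gap `ε` between `a` and `b` pays for the slack allowed by `b ≤ c`; the other half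
-- remains as the new gap.
<-≤-trans : ∀ {a b c} → a < b → b ≤ c → a < c
<-≤-trans {a} {b} {c} (ε , 0<ε , a<b) b≤c = ε ℚ.* ½ , half-pos 0<ε , eventually-zip
  (λ n p q → ≤-from-diff
      (trans (cong (λ e → seq c n ℚ.+ ε ℚ.* ½ ℚ.- (seq a n ℚ.+ e)) (sym (half+half ε)))
        (solve 3 (λ a c h → c :+ h :- (a :+ (h :+ h)) := c :- (a :+ h)) refl (seq a n) (seq c n) (ε ℚ.* ½)))
      (ℚ.≤-trans p q))
  a<b (b≤c _ (half-pos 0<ε))

≤-<-trans : ∀ {a b c} → a ≤ b → b < c → a < c
≤-<-trans {a} {b} {c} a≤b (ε , 0<ε , b<c) = ε ℚ.* ½ , half-pos 0<ε , eventually-zip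
  (λ n p q → ℚ.≤-trans
      (ℚ.+-monoˡ-≤ (ε ℚ.* ½) p)
      (subst (ℚ._≤ seq c n) (sym (trans (ℚ.+-assoc (seq b n) _ _) (cong (seq b n ℚ.+_) (half+half ε)))) q))
  (a≤b _ (half-pos 0<ε)) b<c

<⇒≤ : ∀ {a b} → a < b → a ≤ b
<⇒≤ {a} {b} (ε , 0<ε , a<b) = ≤-eventually {a} {b} (eventually-map
  (λ n → ℚ.≤-trans (≤-+-pos 0<ε)) a<b)

<-irrefl : ∀ {a} → ¬ (a < a)
<-irrefl {a} (ε , 0<ε , N , h) = ℚ.<-irrefl refl
  (ℚ.<-≤-trans (subst (ℚ._< seq a N ℚ.+ ε) (ℚ.+-identityʳ (seq a N)) (ℚ.+-monoʳ-< (seq a N) 0<ε))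
               (h N ℕ.≤-refl))

⟨⟩⇒≤ : ∀ ◁ {a b} → a ⟨ ◁ ⟩ b → a ≤ b
⟨⟩⇒≤ lt {a} {b} = <⇒≤ {a} {b}
⟨⟩⇒≤ le = id

<⇒⟨⟩ : ∀ ◁ {a b} → a < b → a ⟨ ◁ ⟩ b
<⇒⟨⟩ lt = id
<⇒⟨⟩ le {a} {b} = <⇒≤ {a} {b}

<⇒≱ : ∀ {a b} → a < b → ¬ (b ≤ a)
<⇒≱ {a} {b} a<b b≤a = <-irrefl {a} (<-≤-trans {a} {b} {a} a<b b≤a)

⟨⟩-≤-trans : ∀ ◁ {a b c} → a ⟨ ◁ ⟩ b → b ≤ c → a ⟨ ◁ ⟩ c
⟨⟩-≤-trans lt {a} {b} {c} = <-≤-trans {a} {b} {c}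
⟨⟩-≤-trans le {a} {b} {c} = ≤-trans {a} {b} {c}

≤-⟨⟩-trans : ∀ ◁ {a b c} → a ≤ b → b ⟨ ◁ ⟩ c → a ⟨ ◁ ⟩ c
≤-⟨⟩-trans lt {a} {b} {c} = ≤-<-trans {a} {b} {c}
≤-⟨⟩-trans le {a} {b} {c} = ≤-trans {a} {b} {c}

-- Both orders depend only on the termwise difference of the two sequences, so moving terms across
-- an inequality of reals is again a ring equation.
⟨⟩-from-diff : ∀ ◁ {a b a' b'} → (∀ n → seq b n ℚ.- seq a n ≡ seq b' n ℚ.- seq a' n) →
               a ⟨ ◁ ⟩ b → a' ⟨ ◁ ⟩ b'
⟨⟩-from-diff lt {a} {b} {a'} {b'} eq (ε , 0<ε , h) = ε , 0<ε , eventually-map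
  (λ n → ≤-from-diff (trans (lemma (seq a n) (seq b n)) (trans (cong (ℚ._- ε) (eq n)) (sym (lemma (seq a' n) (seq b' n))))))
  h
  where
  lemma : ∀ p q → q ℚ.- (p ℚ.+ ε) ≡ q ℚ.- p ℚ.- ε
  lemma p q = solve 3 (λ p q e → q :- (p :+ e) := q :- p :- e) refl p q ε
⟨⟩-from-diff le {a} {b} {a'} {b'} eq h ε 0<ε = eventually-map
  (λ n → ≤-from-diff (trans (lemma (seq a n) (seq b n)) (trans (cong (ℚ._+ ε) (eq n)) (sym (lemma (seq a' n) (seq b' n))))))
  (h ε 0<ε)
  where
  lemma : ∀ p q → q ℚ.+ ε ℚ.- p ≡ q ℚ.- p ℚ.+ ε
  lemma p q = solve 3 (λ p q e → q :+ e :- p := q :- p :+ e) refl p q ε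

⟨⟩-diff-⇔ : ∀ ◁ {a b a' b'} → (∀ n → seq b n ℚ.- seq a n ≡ seq b' n ℚ.- seq a' n) →
            (a ⟨ ◁ ⟩ b) ⇔ (a' ⟨ ◁ ⟩ b')
⟨⟩-diff-⇔ ◁ {a} {b} {a'} {b'} eq = mk⇔
  (⟨⟩-from-diff ◁ {a} {b} {a'} {b'} eq) (⟨⟩-from-diff ◁ {a'} {b'} {a} {b} (sym ∘ eq))

+-monoˡ-⟨⟩ : ∀ ◁ {a b} c → a ⟨ ◁ ⟩ b → a + c ⟨ ◁ ⟩ b + c
+-monoˡ-⟨⟩ ◁ {a} {b} c = ⟨⟩-from-diff ◁ {a} {b} {a + c} {b + c} λ n →
  solve 3 (λ a b c → b :- a := b :+ c :- (a :+ c)) refl (seq a n) (seq b n) (seq c n)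

fromℤ-mono-≤ : ∀ {i j} → i ℤ.≤ j → fromℤ i ≤ fromℤ j
fromℤ-mono-≤ {i} {j} i≤j = ≤-pointwise {fromℤ i} {fromℤ j} (λ _ → /1-mono-≤ i≤j)

fromℤ-mono-< : ∀ {i j} → i ℤ.< j → fromℤ i < fromℤ j
fromℤ-mono-< {i} {j} i<j =
  q ℚ.- p ,
  subst (ℚ._< q ℚ.- p) (ℚ.+-inverseʳ p) (ℚ.+-monoˡ-< (ℚ.- p) (/1-mono-< i<j)) ,
  0 , λ _ _ → ℚ.≤-reflexive (solve 2 (λ p q → p :+ (q :- p) := q) refl p q)
  where
  p q : ℚ
  p = i ℚ./ 1
  q = j ℚ./ 1

fromℤ-neg<0 : ∀ k → fromℤ -[1+ k ] < fromℕ 0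
fromℤ-neg<0 k = fromℤ-mono-< { -[1+ k ]} {+ 0} ℤ.-<+

≈-pointwise : ∀ {a b} → (∀ n → seq a n ≡ seq b n) → a ≈ b
≈-pointwise {a} {b} eq ε 0<ε = 0 , λ n _ →
  subst (ℚ._≤ ε) (cong ∣_∣ (sym (trans (cong (ℚ._- seq b n) (eq n)) (ℚ.+-inverseʳ (seq b n))))) (ℚ.<⇒≤ 0<ε)

≈-sym : ∀ {a b} → a ≈ b → b ≈ a
≈-sym {a} {b} a≈b ε 0<ε = eventually-map (λ n → subst (ℚ._≤ ε) (∣-∣-comm (seq a n) (seq b n))) (a≈b ε 0<ε)
  where
  ∣-∣-comm : ∀ p q → ∣ p ℚ.- q ∣ ≡ ∣ q ℚ.- p ∣
  ∣-∣-comm p q = trans (sym (ℚ.∣-p∣≡∣p∣ (p ℚ.- q)))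
    (cong ∣_∣ (solve 2 (λ p q → :- (p :- q) := q :- p) refl p q))

≈-trans : ∀ {a b c} → a ≈ b → b ≈ c → a ≈ c
≈-trans {a} {b} {c} a≈b b≈c ε 0<ε = eventually-zip
  (λ n p q → subst₂ ℚ._≤_
    (cong ∣_∣ (solve 3 (λ a b c → (a :- b) :+ (b :- c) := a :- c) refl (seq a n) (seq b n) (seq c n)))
    (half+half ε)
    (ℚ.≤-trans (ℚ.∣p+q∣≤∣p∣+∣q∣ (seq a n ℚ.- seq b n) (seq b n ℚ.- seq c n)) (ℚ.+-mono-≤ p q)))
  (a≈b _ (half-pos 0<ε)) (b≈c _ (half-pos 0<ε))

p≤∣p∣ : ∀ p → p ℚ.≤ ∣ p ∣
p≤∣p∣ p with ℚ.≤-total 0ℚ p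
... | inj₁ 0≤p = ℚ.≤-reflexive (sym (ℚ.0≤p⇒∣p∣≡p 0≤p))
... | inj₂ p≤0 = ℚ.≤-trans p≤0 (ℚ.0≤∣p∣ p)

≈⇒≤ : ∀ {a b} → a ≈ b → a ≤ b
≈⇒≤ {a} {b} a≈b ε 0<ε = eventually-map
  (λ n p → ≤-from-diff
    (solve 3 (λ a b e → e :- (a :- b) := b :+ e :- a) refl (seq a n) (seq b n) ε)
    (ℚ.≤-trans (p≤∣p∣ (seq a n ℚ.- seq b n)) p))
  (a≈b ε 0<ε)

-- Satisfaction of atomic constraints

≈ᵛ-sym : ∀ {n} {v w : Valuation n} → v ≈ᵛ w → w ≈ᵛ v
≈ᵛ-sym {v = v} {w} v≈w x = ≈-sym {value (v x)} {value (w x)} (v≈w x)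

-‿mono-≤ : ∀ {a b c d} → a ≤ b → d ≤ c → a - c ≤ b - d
-‿mono-≤ {a} {b} {c} {d} a≤b d≤c = ≤-trans {a - c} {b - c} {b - d}
  (+-monoˡ-⟨⟩ le {a} {b} (- c) a≤b)
  (⟨⟩-from-diff le {d} {c} {b - c} {b - d} (λ n →
    solve 3 (λ b c d → c :- d := (b :- d) :- (b :- c)) refl (seq b n) (seq c n) (seq d n)) d≤c)

-- Equations between delayed valuations hold only up to `_≈ᵛ_`, so satisfaction has to be carried
-- along that relation.
⊨-cong : ∀ {n} {v w : Valuation n} → v ≈ᵛ w → ∀ φ → v ⊨ φ → w ⊨ φ
⊨-cong {v = v} {w} v≈w = go
  where
  v≤w : ∀ x → value (v x) ≤ value (w x)
  v≤w x = ≈⇒≤ {value (v x)} {value (w x)} (v≈w x)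
  w≤v : ∀ x → value (w x) ≤ value (v x)
  w≤v x = ≈⇒≤ {value (w x)} {value (v x)} (≈ᵛ-sym {v = v} {w} v≈w x)
  go : ∀ φ → v ⊨ φ → w ⊨ φ
  go (upper x ◁ c)       = ≤-⟨⟩-trans ◁ (w≤v x)
  go (lower c ◁ x) h     = ⟨⟩-≤-trans ◁ h (v≤w x)
  go (diffUpper x y ◁ c) = ≤-⟨⟩-trans ◁
    (-‿mono-≤ {value (w x)} {value (v x)} {value (w y)} {value (v y)} (w≤v x) (v≤w y))
  go (diffLower c ◁ x y) h = ⟨⟩-≤-trans ◁ h
    (-‿mono-≤ {value (v x)} {value (w x)} {value (v y)} {value (w y)} (v≤w x) (w≤v y))
  go true _  = tt
  go false ()

⊕-cong : ∀ {n} {v w : Valuation n} δ → v ≈ᵛ w → v ⊕ δ ≈ᵛ w ⊕ δ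
⊕-cong {v = v} {w} δ v≈w x ε 0<ε = eventually-map
  (λ n → subst (ℚ._≤ ε) (cong ∣_∣
    (solve 3 (λ a b c → a :- b := (a :+ c) :- (b :+ c)) refl
      (seq (value (v x)) n) (seq (value (w x)) n) (seq (value δ) n))))
  (v≈w x ε 0<ε)

zeroℝ≥0 : ℝ≥0
zeroℝ≥0 = mkℝ≥0 (fromℕ 0) (≤-refl {fromℕ 0})

⊕-identityʳ : ∀ {n} (v : Valuation n) → v ⊕ zeroℝ≥0 ≈ᵛ v
⊕-identityʳ v x = ≈-pointwise {value ((v ⊕ zeroℝ≥0) x)} {value (v x)} λ n → ℚ.+-identityʳ (seq (value (v x)) n)

infixl 6 _+ᵖ_
_+ᵖ_ : ℝ≥0 → ℝ≥0 → ℝ≥0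
δ +ᵖ η = mkℝ≥0 (value δ + value η) (+-nonneg (value δ) (value η) (nonneg δ) (nonneg η))

⊕-assoc : ∀ {n} (v : Valuation n) δ η → v ⊕ δ ⊕ η ≈ᵛ v ⊕ (δ +ᵖ η)
⊕-assoc v δ η x = ≈-pointwise {value ((v ⊕ δ ⊕ η) x)} {value ((v ⊕ (δ +ᵖ η)) x)} λ n →
  ℚ.+-assoc (seq (value (v x)) n) (seq (value δ) n) (seq (value η) n)

difference-⊕ : ∀ {n} (v : Valuation n) δ x y m →
  seq (value ((v ⊕ δ) x) - value ((v ⊕ δ) y)) m ≡ seq (value (v x) - value (v y)) m
difference-⊕ v δ x y m = solve 3 (λ a b d → (a :+ d) :- (b :+ d) := a :- b) refl
  (seq (value (v x)) m) (seq (value (v y)) m) (seq (value δ) m)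

diffUpper-⊕ : ∀ {n} (v : Valuation n) δ x y ◁ c →
  v ⊕ δ ⊨ diffUpper x y ◁ c ⇔ v ⊨ diffUpper x y ◁ c
diffUpper-⊕ v δ x y ◁ c = ⟨⟩-diff-⇔ ◁ λ m → cong (λ p → + c ℚ./ 1 ℚ.- p) (difference-⊕ v δ x y m)

diffLower-⊕ : ∀ {n} (v : Valuation n) δ x y ◁ c →
  v ⊕ δ ⊨ diffLower c ◁ x y ⇔ v ⊨ diffLower c ◁ x y
diffLower-⊕ v δ x y ◁ c = ⟨⟩-diff-⇔ ◁ λ m → cong (λ p → p ℚ.- + c ℚ./ 1) (difference-⊕ v δ x y m)

-- Correctness of inverse updates

module _ {n} (v : Valuation n) where

  truth-⇔ : ∀ i ◁ j → fromℤ i ⟨ ◁ ⟩ fromℤ j ⇔ v ⊨ truth (i ⟨ ◁ ⟩ℤ? j)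
  truth-⇔ i lt j with i ℤ.<? j
  ... | yes i<j = mk⇔ (λ _ → tt) (λ _ → fromℤ-mono-< i<j)
  ... | no  i≮j = mk⇔ (λ h → <⇒≱ {fromℤ i} {fromℤ j} h (fromℤ-mono-≤ (ℤ.≮⇒≥ i≮j))) λ ()
  truth-⇔ i le j with i ℤ.≤? j
  ... | yes i≤j = mk⇔ (λ _ → tt) (λ _ → fromℤ-mono-≤ i≤j)
  ... | no  i≰j = mk⇔ (<⇒≱ {fromℤ j} {fromℤ i} (fromℤ-mono-< (ℤ.≰⇒> i≰j))) λ ()

  -- Where the atom collapses to `false`, nonnegativity of the clock refutes the inequality.
  upperℤ-⇔ : ∀ y ◁ i → value (v y) ⟨ ◁ ⟩ fromℤ i ⇔ v ⊨ upperℤ y ◁ i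
  upperℤ-⇔ y lt (+ zero)  = mk⇔ (λ h → <⇒≱ {value (v y)} {fromℕ 0} h (nonneg (v y))) λ ()
  upperℤ-⇔ y lt (+ suc c) = mk⇔ id id
  upperℤ-⇔ y le (+ c)     = mk⇔ id id
  upperℤ-⇔ y lt -[1+ k ]  = mk⇔ (λ h → <⇒≱ {value (v y)} {fromℤ -[1+ k ]} h
    (≤-trans {fromℤ -[1+ k ]} {fromℕ 0} {value (v y)} (<⇒≤ {fromℤ -[1+ k ]} {fromℕ 0} (fromℤ-neg<0 k)) (nonneg (v y)))) λ ()
  upperℤ-⇔ y le -[1+ k ]  = mk⇔ (<⇒≱ {fromℤ -[1+ k ]} {value (v y)}
    (<-≤-trans {fromℤ -[1+ k ]} {fromℕ 0} {value (v y)} (fromℤ-neg<0 k) (nonneg (v y)))) λ ()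

  lowerℤ-⇔ : ∀ i ◁ y → fromℤ i ⟨ ◁ ⟩ value (v y) ⇔ v ⊨ lowerℤ i ◁ y
  lowerℤ-⇔ (+ zero)  le y = mk⇔ (λ _ → tt) (λ _ → nonneg (v y))
  lowerℤ-⇔ (+ suc c) le y = mk⇔ id id
  lowerℤ-⇔ (+ zero)  lt y = mk⇔ id id
  lowerℤ-⇔ (+ suc c) lt y = mk⇔ id id
  lowerℤ-⇔ -[1+ k ]  ◁  y = mk⇔ (λ _ → tt) λ _ → <⇒⟨⟩ ◁
    (<-≤-trans {fromℤ -[1+ k ]} {fromℕ 0} {value (v y)} (fromℤ-neg<0 k) (nonneg (v y)))

  -- For equal clocks the difference is 0 and two constants are compared. For a negative bound both
  -- sides are negated, which swaps the clocks.
  diffUpperℤ-⇔ : ∀ x y ◁ i → value (v x) - value (v y) ⟨ ◁ ⟩ fromℤ i ⇔ v ⊨ diffUpperℤ x y ◁ i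
  diffUpperℤ-⇔ x y ◁ i with x Fin.≟ y
  diffUpperℤ-⇔ x y ◁ i | yes refl = ⇔-trans
    (⟨⟩-diff-⇔ ◁ {b' = fromℤ i} λ n → cong (λ p → i ℚ./ 1 ℚ.- p) (ℚ.+-inverseʳ (seq (value (v x)) n)))
    (truth-⇔ (+ 0) ◁ i)
  diffUpperℤ-⇔ x y ◁ (+ c)    | no _ = mk⇔ id id
  diffUpperℤ-⇔ x y ◁ -[1+ c ] | no _ = ⟨⟩-diff-⇔ ◁ λ n →
    solve 3 (λ a b c → :- c :- (a :- b) := (b :- a) :- c) refl
      (seq (value (v x)) n) (seq (value (v y)) n) (+ suc c ℚ./ 1)

  diffLowerℤ-⇔ : ∀ i ◁ x y → fromℤ i ⟨ ◁ ⟩ value (v x) - value (v y) ⇔ v ⊨ diffLowerℤ i ◁ x y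
  diffLowerℤ-⇔ i ◁ x y with x Fin.≟ y
  diffLowerℤ-⇔ i ◁ x y | yes refl = ⇔-trans
    (⟨⟩-diff-⇔ ◁ {a' = fromℤ i} λ n → cong (ℚ._- i ℚ./ 1) (ℚ.+-inverseʳ (seq (value (v x)) n)))
    (truth-⇔ i ◁ (+ 0))
  diffLowerℤ-⇔ (+ c)    ◁ x y | no _ = mk⇔ id id
  diffLowerℤ-⇔ -[1+ c ] ◁ x y | no _ = ⟨⟩-diff-⇔ ◁ λ n →
    solve 3 (λ a b c → (a :- b) :- (:- c) := c :- (b :- a)) refl
      (seq (value (v x)) n) (seq (value (v y)) n) (+ suc c ℚ./ 1)

  substUpper-⇔ : ∀ e ◁ i → eval v e ⟨ ◁ ⟩ fromℤ i ⇔ v ⊨ substUpper e ◁ i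
  substUpper-⇔ (const k)   ◁ i = truth-⇔ (+ k) ◁ i
  substUpper-⇔ (shift y d) ◁ i = ⇔-trans
    (⟨⟩-diff-⇔ ◁ λ n → trans
      (solve 3 (λ a d i → i :- (a :+ d) := (i :- d) :- a) refl (seq (value (v y)) n) (d ℚ./ 1) (i ℚ./ 1))
      (cong (ℚ._- seq (value (v y)) n) (sym (/1-minus i d))))
    (upperℤ-⇔ y ◁ (i ℤ.- d))

  substLower-⇔ : ∀ i ◁ e → fromℤ i ⟨ ◁ ⟩ eval v e ⇔ v ⊨ substLower i ◁ e
  substLower-⇔ i ◁ (const k)   = truth-⇔ i ◁ (+ k)
  substLower-⇔ i ◁ (shift y d) = ⇔-trans
    (⟨⟩-diff-⇔ ◁ λ n → trans
      (solve 3 (λ a d i → (a :+ d) :- i := a :- (i :- d)) refl (seq (value (v y)) n) (d ℚ./ 1) (i ℚ./ 1))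
      (cong (λ p → seq (value (v y)) n ℚ.- p) (sym (/1-minus i d))))
    (lowerℤ-⇔ (i ℤ.- d) ◁ y)

  substDiffUpper-⇔ : ∀ e f ◁ i → eval v e - eval v f ⟨ ◁ ⟩ fromℤ i ⇔ v ⊨ substDiffUpper e f ◁ i
  substDiffUpper-⇔ e (const l) ◁ i = ⇔-trans
    (⟨⟩-diff-⇔ ◁ λ n → trans
      (solve 3 (λ a i l → i :- (a :- l) := (i :+ l) :- a) refl (seq (eval v e) n) (i ℚ./ 1) (+ l ℚ./ 1))
      (cong (ℚ._- seq (eval v e) n) (sym (/1-+ i (+ l)))))
    (substUpper-⇔ e ◁ (i ℤ.+ + l))
  -- The clock `z` occurs negatively, so the upper bound on the difference becomes a lower bound on
  -- `z`.
  substDiffUpper-⇔ (const k) (shift z e) ◁ i = ⇔-trans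
    (⟨⟩-diff-⇔ ◁ λ n → trans
      (solve 4 (λ a k e i → i :- (k :- (a :+ e)) := a :- ((k :- e) :- i)) refl
        (seq (value (v z)) n) (+ k ℚ./ 1) (e ℚ./ 1) (i ℚ./ 1))
      (cong (λ p → seq (value (v z)) n ℚ.- p) (sym (/1-minus-minus (+ k) e i))))
    (lowerℤ-⇔ (+ k ℤ.- e ℤ.- i) ◁ z)
  substDiffUpper-⇔ (shift y d) (shift z e) ◁ i = ⇔-trans
    (⟨⟩-diff-⇔ ◁ λ n → trans
      (solve 5 (λ a b d e i → i :- ((a :+ d) :- (b :+ e)) := (i :+ e :- d) :- (a :- b)) refl
        (seq (value (v y)) n) (seq (value (v z)) n) (d ℚ./ 1) (e ℚ./ 1) (i ℚ./ 1))
      (cong (ℚ._- (seq (value (v y) - value (v z)) n)) (sym (/1-+-minus i e d))))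
    (diffUpperℤ-⇔ y z ◁ (i ℤ.+ e ℤ.- d))

  substDiffLower-⇔ : ∀ i ◁ e f → fromℤ i ⟨ ◁ ⟩ eval v e - eval v f ⇔ v ⊨ substDiffLower i ◁ e f
  substDiffLower-⇔ i ◁ e (const l) = ⇔-trans
    (⟨⟩-diff-⇔ ◁ λ n → trans
      (solve 3 (λ a i l → (a :- l) :- i := a :- (i :+ l)) refl (seq (eval v e) n) (i ℚ./ 1) (+ l ℚ./ 1))
      (cong (λ p → seq (eval v e) n ℚ.- p) (sym (/1-+ i (+ l)))))
    (substLower-⇔ (i ℤ.+ + l) ◁ e)
  substDiffLower-⇔ i ◁ (const k) (shift z e) = ⇔-trans
    (⟨⟩-diff-⇔ ◁ λ n → trans
      (solve 4 (λ a k e i → (k :- (a :+ e)) :- i := ((k :- e) :- i) :- a) refl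
        (seq (value (v z)) n) (+ k ℚ./ 1) (e ℚ./ 1) (i ℚ./ 1))
      (cong (ℚ._- seq (value (v z)) n) (sym (/1-minus-minus (+ k) e i))))
    (upperℤ-⇔ z ◁ (+ k ℤ.- e ℤ.- i))
  substDiffLower-⇔ i ◁ (shift y d) (shift z e) = ⇔-trans
    (⟨⟩-diff-⇔ ◁ λ n → trans
      (solve 5 (λ a b d e i → ((a :+ d) :- (b :+ e)) :- i := (a :- b) :- (i :+ e :- d)) refl
        (seq (value (v y)) n) (seq (value (v z)) n) (d ℚ./ 1) (e ℚ./ 1) (i ℚ./ 1))
      (cong (λ p → seq (value (v y) - value (v z)) n ℚ.- p) (sym (/1-+-minus i e d))))
    (diffLowerℤ-⇔ (i ℤ.+ e ℤ.- d) ◁ y z)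

-- Comparing two reals through delayed bounds

-- In the non-strict case the delay `c - a` brings `a` exactly to the bound, and `b + (c - a) ≤ c`
-- says `b ≤ a`. The undelayed bound makes this delay nonnegative.
≤-from-delayed-upper : ∀ ◁ {a b c} → (∀ δ → a + value δ ⟨ ◁ ⟩ c → b + value δ ⟨ ◁ ⟩ c) →
                       a ⟨ ◁ ⟩ c → b ≤ a
≤-from-delayed-upper le {a} {b} {c} delayed a≤c =
  ⟨⟩-from-diff le {b + (c - a)} {c} {b} {a}
    (λ n → solve 3 (λ a b c → c :- (b :+ (c :- a)) := a :- b) refl (seq a n) (seq b n) (seq c n))
    (delayed δ (≤-pointwise {a + (c - a)} {c} λ n → ℚ.≤-reflexive
      (solve 2 (λ a c → a :+ (c :- a) := c) refl (seq a n) (seq c n))))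
  where
  δ : ℝ≥0
  δ = mkℝ≥0 (c - a) (⟨⟩-from-diff le {a} {c} {fromℕ 0} {c - a}
    (λ n → sym (ℚ.+-identityʳ (seq c n ℚ.- seq a n))) a≤c)
-- The delay c - a is not available under a strict bound; delays c - a - η with η small are.
≤-from-delayed-upper lt {a} {b} {c} delayed (ε₀ , 0<ε₀ , a<c) ε 0<ε = eventually-map
  -- With `δ` equal to `c - a - η`, the inequality `b + δ ≤ c` rearranges to `b ≤ a + η`.
  (λ n b+δ≤c → ℚ.≤-trans
    (≤-from-diff
      (solve 4 (λ a b c h → c :- (b :+ (c :- a :- h)) := a :+ h :- b) refl (seq a n) (seq b n) (seq c n) η)
      (ℚ.≤-trans (≤-+-pos 0<ε₁) b+δ≤c))
    (ℚ.+-monoʳ-≤ (seq a n) (ℚ.p⊓q≤p ε ε₀)))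
  b+δ<c
  where
  -- `η ≤ ε` keeps the error within the requested one; `η ≤ ε₀`, the gap between `a` and `c`, keeps
  -- the delay nonnegative.
  η : ℚ
  η = ε ℚ.⊓ ε₀

  0<η : 0ℚ ℚ.< η
  0<η with ℚ.⊓-sel ε ε₀
  ... | inj₁ η≡ε  = subst (0ℚ ℚ.<_) (sym η≡ε) 0<ε
  ... | inj₂ η≡ε₀ = subst (0ℚ ℚ.<_) (sym η≡ε₀) 0<ε₀

  d : ℝ
  d = c - a - mkℝ (λ _ → η) (const-cauchy η)

  δ : ℝ≥0
  δ = mkℝ≥0 d (≤-eventually {fromℕ 0} {d} (eventually-map
    (λ n h → ≤-from-diff
      (solve 3 (λ a c h → c :- (a :+ h) := (c :- a :- h) :- con 0ℚ) refl (seq a n) (seq c n) η)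
      (ℚ.≤-trans (ℚ.+-monoʳ-≤ (seq a n) (ℚ.p⊓q≤q ε ε₀)) h))
    a<c))

  delayed-δ : b + d < c
  -- After this delay `a` falls short of `c` by exactly `η`, which witnesses the strict premise.
  delayed-δ = delayed δ (η , 0<η , 0 , λ n _ → ℚ.≤-reflexive
    (solve 3 (λ a c h → a :+ (c :- a :- h) :+ h := c) refl (seq a n) (seq c n) η))

  0<ε₁ = proj₁ (proj₂ delayed-δ)
  b+δ<c = proj₂ (proj₂ delayed-δ)

-- At the delay `c - a` the first real meets the bound with equality. The transferred bound is
-- non-strict, so this delay works even if the guard bounds the clock strictly.
≤-from-delayed-lower : ∀ {a b c} → (∀ δ → c ≤ a + value δ → c ≤ b + value δ) → a ≤ c → a ≤ b
≤-from-delayed-lower {a} {b} {c} delayed a≤c =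
  ⟨⟩-from-diff le {c} {b + (c - a)} {a} {b}
    (λ n → solve 3 (λ a b c → (b :+ (c :- a)) :- c := b :- a) refl (seq a n) (seq b n) (seq c n))
    (delayed δ (≤-pointwise {c} {a + (c - a)} λ n → ℚ.≤-reflexive
      (solve 2 (λ a c → c := a :+ (c :- a)) refl (seq a n) (seq c n))))
  where
  δ : ℝ≥0
  δ = mkℝ≥0 (c - a) (⟨⟩-from-diff le {a} {c} {fromℕ 0} {c - a}
    (λ n → sym (ℚ.+-identityʳ (seq c n ℚ.- seq a n))) a≤c)

-- Bounds occurring in a guard

∈-uppers⁻ : ∀ {n} (x : Fin n) g {c} → c ∈ uppers x g → ∃[ ◁ ] upper x ◁ c ∈ g
∈-uppers⁻ x (upper z ◁ c ∷ g) h with z Fin.≟ x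
∈-uppers⁻ x (upper z ◁ c ∷ g) (here refl) | yes refl = ◁ , here refl
∈-uppers⁻ x (upper z ◁ c ∷ g) (there h)   | yes _    = map₂ there (∈-uppers⁻ x g h)
∈-uppers⁻ x (upper z ◁ c ∷ g) h           | no _     = map₂ there (∈-uppers⁻ x g h)
∈-uppers⁻ x (lower _ _ _ ∷ g) h       = map₂ there (∈-uppers⁻ x g h)
∈-uppers⁻ x (diffUpper _ _ _ _ ∷ g) h = map₂ there (∈-uppers⁻ x g h)
∈-uppers⁻ x (diffLower _ _ _ _ ∷ g) h = map₂ there (∈-uppers⁻ x g h)
∈-uppers⁻ x (true ∷ g) h              = map₂ there (∈-uppers⁻ x g h)
∈-uppers⁻ x (false ∷ g) h             = map₂ there (∈-uppers⁻ x g h)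

∈-diffUppers⁻ : ∀ {n} (x y : Fin n) g {c} → c ∈ diffUppers x y g → ∃[ ◁ ] diffUpper x y ◁ c ∈ g
∈-diffUppers⁻ x y (diffUpper z w ◁ c ∷ g) h with z Fin.≟ x | w Fin.≟ y
∈-diffUppers⁻ x y (diffUpper z w ◁ c ∷ g) (here refl) | yes refl | yes refl = ◁ , here refl
∈-diffUppers⁻ x y (diffUpper z w ◁ c ∷ g) (there h) | yes _ | yes _ = map₂ there (∈-diffUppers⁻ x y g h)
∈-diffUppers⁻ x y (diffUpper z w ◁ c ∷ g) h | yes _ | no _ = map₂ there (∈-diffUppers⁻ x y g h)
∈-diffUppers⁻ x y (diffUpper z w ◁ c ∷ g) h | no _  | _    = map₂ there (∈-diffUppers⁻ x y g h)
∈-diffUppers⁻ x y (upper _ _ _ ∷ g) h       = map₂ there (∈-diffUppers⁻ x y g h)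
∈-diffUppers⁻ x y (lower _ _ _ ∷ g) h       = map₂ there (∈-diffUppers⁻ x y g h)
∈-diffUppers⁻ x y (diffLower _ _ _ _ ∷ g) h = map₂ there (∈-diffUppers⁻ x y g h)
∈-diffUppers⁻ x y (true ∷ g) h              = map₂ there (∈-diffUppers⁻ x y g h)
∈-diffUppers⁻ x y (false ∷ g) h             = map₂ there (∈-diffUppers⁻ x y g h)

∈-diffLowers⁻ : ∀ {n} (x y : Fin n) g {c} → c ∈ diffLowers x y g → ∃[ ◁ ] diffLower c ◁ x y ∈ g
∈-diffLowers⁻ x y (diffLower c ◁ z w ∷ g) h with z Fin.≟ x | w Fin.≟ y
∈-diffLowers⁻ x y (diffLower c ◁ z w ∷ g) (here refl) | yes refl | yes refl = ◁ , here refl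
∈-diffLowers⁻ x y (diffLower c ◁ z w ∷ g) (there h) | yes _ | yes _ = map₂ there (∈-diffLowers⁻ x y g h)
∈-diffLowers⁻ x y (diffLower c ◁ z w ∷ g) h | yes _ | no _ = map₂ there (∈-diffLowers⁻ x y g h)
∈-diffLowers⁻ x y (diffLower c ◁ z w ∷ g) h | no _  | _    = map₂ there (∈-diffLowers⁻ x y g h)
∈-diffLowers⁻ x y (upper _ _ _ ∷ g) h       = map₂ there (∈-diffLowers⁻ x y g h)
∈-diffLowers⁻ x y (lower _ _ _ ∷ g) h       = map₂ there (∈-diffLowers⁻ x y g h)
∈-diffLowers⁻ x y (diffUpper _ _ _ _ ∷ g) h = map₂ there (∈-diffLowers⁻ x y g h)
∈-diffLowers⁻ x y (true ∷ g) h              = map₂ there (∈-diffLowers⁻ x y g h)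
∈-diffLowers⁻ x y (false ∷ g) h             = map₂ there (∈-diffLowers⁻ x y g h)

-- Each test finds a guard atom that puts `x - y` on one side of `d`. The conclusion is strict so
-- that it settles both the strict and the non-strict comparisons with `d`.
diffDecided-sound : ∀ {n} (g : Guard n) x y d → diffDecided g x y d ≡ true →
  (∀ v → v ⊨ᵍ g → v ⊨ diffUpper x y lt d) ⊎ (∀ v → v ⊨ᵍ g → v ⊨ diffLower d lt x y)
diffDecided-sound g x y d decided with any? (ℕ._<? d) (uppers x g)
... | yes x<d =
  let c , c∈ , c<d = find x<d
      ◁ , ∈g = ∈-uppers⁻ x g c∈
  -- Since `y` is nonnegative, `x - y ≤ x ≤ c < d`.
  in inj₁ λ v v⊨g → ≤-<-trans {value (v x) - value (v y)} {fromℕ c} {fromℕ d}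
       (≤-trans {value (v x) - value (v y)} {value (v x)} {fromℕ c}
         (⟨⟩-from-diff le {fromℕ 0} {value (v y)} {value (v x) - value (v y)} {value (v x)}
           (λ n → solve 2 (λ a b → b :- con 0ℚ := a :- (a :- b)) refl (seq (value (v x)) n) (seq (value (v y)) n))
           (nonneg (v y)))
         (⟨⟩⇒≤ ◁ (All.lookup v⊨g ∈g)))
       (fromℤ-mono-< (ℤ.+<+ c<d))
... | no _ with any? (ℕ._<? d) (diffUppers x y g)
...   | yes x-y<d =
  let c , c∈ , c<d = find x-y<d
      ◁ , ∈g = ∈-diffUppers⁻ x y g c∈
  in inj₁ λ v v⊨g → ≤-<-trans {value (v x) - value (v y)} {fromℕ c} {fromℕ d}
       (⟨⟩⇒≤ ◁ (All.lookup v⊨g ∈g)) (fromℤ-mono-< (ℤ.+<+ c<d))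
...   | no _ with any? (d ℕ.<?_) (diffLowers x y g)
...     | yes d<x-y =
  let c , c∈ , d<c = find d<x-y
      ◁ , ∈g = ∈-diffLowers⁻ x y g c∈
  in inj₂ λ v v⊨g → <-≤-trans {fromℕ d} {fromℕ c} {value (v x) - value (v y)}
       (fromℤ-mono-< (ℤ.+<+ d<c)) (⟨⟩⇒≤ ◁ (All.lookup v⊨g ∈g))
diffDecided-sound g x y d () | no _ | no _ | no _

-- Transfer of atomic constraints along the preorder

-- Stated for a single atom because `up ⁻¹[ φ ]` need not belong to the set `G`; only its `pre`
-- does.
Transfers : ∀ {n} → Valuation n → Valuation n → Atom n → Set
Transfers v v' ψ = ∀ δ → v ⊕ δ ⊨ ψ → v' ⊕ δ ⊨ ψ

-- This is the zero delay, which returns the original valuation up to `_≈ᵛ_`.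
transfer-undelayed : ∀ {n} {v v' : Valuation n} ψ → Transfers v v' ψ → v ⊨ ψ → v' ⊨ ψ
transfer-undelayed {v = v} {v'} ψ transfers v⊨ψ = ⊨-cong {v = v' ⊕ zeroℝ≥0} {v'} (⊕-identityʳ v') ψ
  (transfers zeroℝ≥0 (⊨-cong {v = v} {v ⊕ zeroℝ≥0} (≈ᵛ-sym {v = v ⊕ zeroℝ≥0} {v} (⊕-identityʳ v)) ψ v⊨ψ))

module _ {n ℓ} {G : Pred (Atom n) ℓ} {v v' : Valuation n} {g : Guard n}
         (v⊑v' : v ⊑[ G ] v') (g⊆G : ∀ {φ} → φ ∈ g → G φ) (v⊨g : v ⊨ᵍ g) where

  guard-transfer : v' ⊨ᵍ g
  guard-transfer = All.tabulate λ {φ} φ∈g → transfer-undelayed {v = v} {v'} φ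
    (λ δ → v⊑v' δ φ (g⊆G φ∈g)) (All.lookup v⊨g φ∈g)

  -- If the guard bounds `x` above, `pre` is `true` and carries no information. The guard atom
  -- itself lies in `G` and yields `v'(x) ≤ v(x)`.
  preUpper-transfer : ∀ x ◁ d → G (preUpper g x ◁ d) → Transfers v v' (upper x ◁ d)
  preUpper-transfer x ◁ d Gψ with uppers x g in eq
  ... | []    = λ δ → v⊑v' δ (upper x ◁ d) Gψ
  ... | c ∷ _ = λ δ → ≤-⟨⟩-trans ◁ (+-monoˡ-⟨⟩ le {value (v' x)} {value (v x)} (value δ) v'x≤vx)
    where
    v'x≤vx : value (v' x) ≤ value (v x)
    v'x≤vx =
      let ◂ , ∈g = ∈-uppers⁻ x g (subst (c ∈_) (sym eq) (here refl))
      in ≤-from-delayed-upper ◂ {value (v x)} {value (v' x)} {fromℕ c}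
           (λ δ → v⊑v' δ (upper x ◂ c) (g⊆G ∈g)) (All.lookup v⊨g ∈g)

  -- In the replaced case `G` contains `e ≤ x` for a bound `e` that the guard imposes on `x`.
  -- Together they give `v(x) ≤ v'(x)`.
  preLower-transfer : ∀ {choose} → (∀ cs → choose cs ∈ toList cs) →
    ∀ d ◁ x → G (preLower choose g d ◁ x) → Transfers v v' (lower d ◁ x)
  preLower-transfer {choose} choose-∈ d ◁ x Gψ with filter (ℕ._<? d) (uppers x g) in eq
  ... | []     = λ δ → v⊑v' δ (lower d ◁ x) Gψ
  ... | c ∷ cs = λ δ d◁vx → ⟨⟩-≤-trans ◁ d◁vx
                   (+-monoˡ-⟨⟩ le {value (v x)} {value (v' x)} (value δ) vx≤v'x)
    where
    e : ℕ
    e = choose (c ∷⁺ cs)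
    vx≤v'x : value (v x) ≤ value (v' x)
    vx≤v'x =
      let e∈ , _ = ∈-filter⁻ (ℕ._<? d) (subst (e ∈_) (sym eq) (choose-∈ (c ∷⁺ cs)))
          ◂ , ∈g = ∈-uppers⁻ x g e∈
      in ≤-from-delayed-lower {value (v x)} {value (v' x)} {fromℕ e}
           (λ δ → v⊑v' δ (lower e le x) Gψ) (⟨⟩⇒≤ ◂ (All.lookup v⊨g ∈g))

  -- A dropped diagonal atom is settled by the guard: either it holds in `v'`, which satisfies the
  -- guard too, or it already fails in `v`. Delays do not change the difference.
  preAtom-transfer : ∀ {choose} → (∀ cs → choose cs ∈ toList cs) →
    ∀ ψ → G (preAtom choose g ψ) → Transfers v v' ψ
  preAtom-transfer choose-∈ (upper x ◁ d) = preUpper-transfer x ◁ d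
  preAtom-transfer choose-∈ (lower d ◁ x) = preLower-transfer choose-∈ d ◁ x
  preAtom-transfer choose-∈ (diffUpper x y ◁ d) Gψ with diffDecided g x y d in eq
  ... | false = λ δ → v⊑v' δ (diffUpper x y ◁ d) Gψ
  ... | true with diffDecided-sound g x y d eq
  ...   | inj₁ below = λ δ _ → from (diffUpper-⊕ v' δ x y ◁ d) (<⇒⟨⟩ ◁ (below v' guard-transfer))
  ...   | inj₂ above = λ δ h → ⊥-elim (<⇒≱ {fromℕ d} {value (v x) - value (v y)}
                         (above v v⊨g) (⟨⟩⇒≤ ◁ (to (diffUpper-⊕ v δ x y ◁ d) h)))
  preAtom-transfer choose-∈ (diffLower d ◁ x y) Gψ with diffDecided g x y d in eq
  ... | false = λ δ → v⊑v' δ (diffLower d ◁ x y) Gψ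
  ... | true with diffDecided-sound g x y d eq
  ...   | inj₁ below = λ δ h → ⊥-elim (<⇒≱ {value (v x) - value (v y)} {fromℕ d}
                         (below v v⊨g) (⟨⟩⇒≤ ◁ (to (diffLower-⊕ v δ x y ◁ d) h)))
  ...   | inj₂ above = λ δ _ → from (diffLower-⊕ v' δ x y ◁ d) (<⇒⟨⟩ ◁ (above v' guard-transfer))
  preAtom-transfer choose-∈ true  _ δ _ = tt
  preAtom-transfer choose-∈ false _ δ ()

-- Transfer through updates.

module _ {n} {v v' : Valuation n} where

  -- Definedness of the update at `x` is the constraint `0 ≤ x` pulled back along the update.
  defined-transfer : ∀ (up : Update n) x → Transfers v v' (up ⁻¹[ lower 0 le x ]) →
                     fromℕ 0 ≤ eval v (up x) → fromℕ 0 ≤ eval v' (up x)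
  defined-transfer up x transfers h = from (substLower-⇔ v' (+ 0) le (up x))
    (transfer-undelayed {v = v} {v'} (substLower (+ 0) le (up x)) transfers
      (to (substLower-⇔ v (+ 0) le (up x)) h))

  shift-⊕ : ∀ (w : Valuation n) y d δ m →
            seq (eval w (shift y d) + value δ) m ≡ seq (eval (w ⊕ δ) (shift y d)) m
  shift-⊕ w y d δ m = solve 3 (λ a d e → (a :+ d) :+ e := (a :+ e) :+ d) refl
    (seq (value (w y)) m) (d ℚ./ 1) (seq (value δ) m)

  -- A constant has the same value under `v` and `v'`. For `y + d` the delay after the update is
  -- moved before it, where the hypothesis applies.
  substUpper-transfer : ∀ e ◁ c → Transfers v v' (substUpper e ◁ (+ c)) →
    ∀ δ → eval v e + value δ ⟨ ◁ ⟩ fromℕ c → eval v' e + value δ ⟨ ◁ ⟩ fromℕ c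
  substUpper-transfer (const k)   ◁ c transfers δ = id
  substUpper-transfer (shift y d) ◁ c transfers δ =
    from (delayed v') ∘ transfers δ ∘ to (delayed v)
    where
    delayed : ∀ w → eval w (shift y d) + value δ ⟨ ◁ ⟩ fromℕ c ⇔ w ⊕ δ ⊨ substUpper (shift y d) ◁ (+ c)
    delayed w = ⇔-trans (⟨⟩-diff-⇔ ◁ λ m → cong (λ p → + c ℚ./ 1 ℚ.- p) (shift-⊕ w y d δ m))
                        (substUpper-⇔ (w ⊕ δ) (shift y d) ◁ (+ c))

  substLower-transfer : ∀ c ◁ e → Transfers v v' (substLower (+ c) ◁ e) →
    ∀ δ → fromℕ c ⟨ ◁ ⟩ eval v e + value δ → fromℕ c ⟨ ◁ ⟩ eval v' e + value δ
  substLower-transfer c ◁ (const k)   transfers δ = id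
  substLower-transfer c ◁ (shift y d) transfers δ =
    from (delayed v') ∘ transfers δ ∘ to (delayed v)
    where
    delayed : ∀ w → fromℕ c ⟨ ◁ ⟩ eval w (shift y d) + value δ ⇔ w ⊕ δ ⊨ substLower (+ c) ◁ (shift y d)
    delayed w = ⇔-trans (⟨⟩-diff-⇔ ◁ λ m → cong (ℚ._- + c ℚ./ 1) (shift-⊕ w y d δ m))
                        (substLower-⇔ (w ⊕ δ) (+ c) ◁ (shift y d))

  -- Diagonal constraints are insensitive to the delay after the update, but their inverse
  -- images need not be diagonal, so they are transferred before any delay.
  apply-transfer : ∀ (up : Update n) (up≥0 : Defined up v) (up'≥0 : Defined up v') φ →
    Transfers v v' (up ⁻¹[ φ ]) → Transfers (apply up v up≥0) (apply up v' up'≥0) φ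
  apply-transfer up _ _ (upper x ◁ c) = substUpper-transfer (up x) ◁ c
  apply-transfer up _ _ (lower c ◁ x) = substLower-transfer c ◁ (up x)
  apply-transfer up up≥0 up'≥0 φ@(diffUpper x y ◁ c) transfers δ =
    from (diffUpper-⊕ (apply up v' up'≥0) δ x y ◁ c) ∘
    from (substDiffUpper-⇔ v' (up x) (up y) ◁ (+ c)) ∘
    transfer-undelayed {v = v} {v'} (up ⁻¹[ φ ]) transfers ∘
    to (substDiffUpper-⇔ v (up x) (up y) ◁ (+ c)) ∘
    to (diffUpper-⊕ (apply up v up≥0) δ x y ◁ c)
  apply-transfer up up≥0 up'≥0 φ@(diffLower c ◁ x y) transfers δ =
    from (diffLower-⊕ (apply up v' up'≥0) δ x y ◁ c) ∘
    from (substDiffLower-⇔ v' (+ c) ◁ (up x) (up y)) ∘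
    transfer-undelayed {v = v} {v'} (up ⁻¹[ φ ]) transfers ∘
    to (substDiffLower-⇔ v (+ c) ◁ (up x) (up y)) ∘
    to (diffLower-⊕ (apply up v up≥0) δ x y ◁ c)
  apply-transfer up _ _ true  _ δ _ = tt
  apply-transfer up _ _ false _ δ ()

-- The preorder on configurations and the simulation conditions.

≈-refl : ∀ {a} → a ≈ a
≈-refl {a} = ≈-pointwise {a} {a} λ _ → refl

≈ᶜ-isEquivalence : ∀ 𝒜 → IsEquivalence (_≈ᶜ_ 𝒜)
≈ᶜ-isEquivalence 𝒜 = record
  { refl  = λ { {q , v} → refl , λ x → ≈-refl {value (v x)} }
  ; sym   = λ { {_ , v} {_ , w} (q≡r , v≈w) → sym q≡r , ≈ᵛ-sym {v = v} {w} v≈w }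
  ; trans = λ { {_ , u} {_ , v} {_ , w} (p≡q , u≈v) (q≡r , v≈w) →
      trans p≡q q≡r , λ x → ≈-trans {value (u x)} {value (v x)} {value (w x)} (u≈v x) (v≈w x) }
  }

GSim-isPreorder : ∀ {ℓ} 𝒜 (𝒢 : UTA.State 𝒜 → Pred (Atom (UTA.nX 𝒜)) ℓ) →
                  IsPreorder (_≈ᶜ_ 𝒜) (GSim 𝒜 𝒢)
GSim-isPreorder 𝒜 𝒢 = record
  { isEquivalence = ≈ᶜ-isEquivalence 𝒜
  ; reflexive     = λ { {_ , v} {_ , w} (q≡r , v≈w) →
      q≡r , λ δ φ _ → ⊨-cong {v = v ⊕ δ} {w ⊕ δ} (⊕-cong {v = v} {w} δ v≈w) φ }
  ; trans         = λ { (refl , u⊑v) (refl , v⊑w) → refl , λ δ φ Gφ → v⊑w δ φ Gφ ∘ u⊑v δ φ Gφ }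
  }

-- The preorder quantifies over all delays, and two successive delays merge into their sum.
⊑-delay : ∀ {n ℓ} {G : Pred (Atom n) ℓ} {v v' : Valuation n} → v ⊑[ G ] v' →
          ∀ δ → v ⊕ δ ⊑[ G ] v' ⊕ δ
⊑-delay {v = v} {v'} v⊑v' δ η φ Gφ =
  ⊨-cong {v = v' ⊕ (δ +ᵖ η)} {v' ⊕ δ ⊕ η} (≈ᵛ-sym {v = v' ⊕ δ ⊕ η} {v' ⊕ (δ +ᵖ η)} (⊕-assoc v' δ η)) φ ∘
  v⊑v' (δ +ᵖ η) φ Gφ ∘
  ⊨-cong {v = v ⊕ δ ⊕ η} {v ⊕ (δ +ᵖ η)} (⊕-assoc v δ η) φ

theorem11 : ∀ {ℓ} (𝒜 : UTA) (S : Selector (UTA.nX 𝒜))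
    (𝒢 : UTA.State 𝒜 → Pred (Atom (UTA.nX 𝒜)) ℓ) →
    IsReducedGMap 𝒜 S 𝒢 → IsSimulation 𝒜 (GSim 𝒜 𝒢)
theorem11 𝒜 S 𝒢 reduced = record
  { isPreorder = GSim-isPreorder 𝒜 𝒢
  ; same-state = proj₁
  ; delay      = λ { {_} {v} {v'} (refl , v⊑v') δ → refl , ⊑-delay {v = v} {v'} v⊑v' δ }
  ; action     = action
  }
  where
  open IsReducedGMap reduced
  open Transition

  action : ∀ {q v v' t q₁ v₁} → t ∈ UTA.transitions 𝒜 → GSim 𝒜 𝒢 (q , v) (q , v') →
           _—[_]→_ 𝒜 (q , v) t (q₁ , v₁) →
           ∃[ v₁' ] (_—[_]→_ 𝒜 (q , v') t (q₁ , v₁') × GSim 𝒜 𝒢 (q₁ , v₁) (q₁ , v₁'))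
  action {v = v} {v'} {t} {v₁ = v₁} t∈T (refl , v⊑v')
    record { at-source = refl ; at-target = refl ; enabled = v⊨g ; defined = up≥0 ; updated = v₁≈up } =
    v₁' ,
    record { at-source = refl ; at-target = refl
           ; enabled = guard-transfer {v = v} {v'} v⊑v' (guard-atoms t∈T) v⊨g
           ; defined = up'≥0
           ; updated = λ x → ≈-refl {value (v₁' x)} } ,
    refl , λ δ φ Gφ →
      -- Composed from right to left: satisfaction passes from `v₁` to the update of `v`, equal to
      -- it only up to `_≈ᵛ_`, and from there to the update of `v'`.
      apply-transfer {v = v} {v'} (update t) up≥0 up'≥0 φ (pre-transfer φ (pre-closed t∈T Gφ)) δ ∘
      ⊨-cong {v = v₁ ⊕ δ} {apply (update t) v up≥0 ⊕ δ}
        (⊕-cong {v = v₁} {apply (update t) v up≥0} δ v₁≈up) φ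
    where
    -- Used for the atoms of the target state and also for `0 ≤ x`, which makes the update defined
    -- at `v'`.
    pre-transfer : ∀ φ → 𝒢 (source t) (pre S φ (guard t) (update t)) →
                   Transfers v v' (update t ⁻¹[ φ ])
    pre-transfer φ = preAtom-transfer {v = v} {v'} v⊑v' (guard-atoms t∈T) v⊨g
      (Selector.select-∈ S φ (guard t) (update t)) (update t ⁻¹[ φ ])

    up'≥0 : Defined (update t) v'
    up'≥0 x = defined-transfer {v = v} {v'} (update t) x
      (pre-transfer (lower 0 le x) (pre-nonneg t∈T x)) (up≥0 x)

    v₁' : Valuation (UTA.nX 𝒜)
    v₁' = apply (update t) v' up'≥0
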